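{- Let $A$ be a set (of labels) and let $\mathbb{M}=\mathsf{LCoalg}(1,\mathcal{D}_{\le 1}(A\times -))$ be the category of pointed $\mathcal{D}_{\le 1}(A\times -)$-coalgebras and lax homomorphisms. (1) There is no category $\mathbb{P}$ and no functor $J\colon\mathbb{P}\to\mathbb{M}$ such that for every morphism $h\colon X\to Y$ of $\mathbb{M}$ with $X$ reachable: $h$ is $J$-open if and only if $h$ is a proper homomorphism. (2) There is no category $\mathbb{P}$ and no functor $J\colon\mathbb{P}\to\mathbb{M}$ such that for all objects $X,Y$ of $\mathbb{M}$: $X$ and $Y$ are $J$-bisimilar if and only if $X$ and $Y$ are coalgebraically bisimilar.
   Context: For a set $X$, $\mathcal{D}_{\le 1}X$ is the set of finitely supported functions $\mu\colon X\to[0,1]$ with $\sum_{x}\mu(x)\le 1$; on maps, $\mathcal{D}_{\le1}(f)(\mu)(y)=\sum_{f(x)=y}\mu(x)$. Put $F=\mathcal{D}_{\le 1}(A\times -)\colon\mathsf{Set}\to\mathsf{Set}$. A pointed coalgebra $(X,\xi,x_0)$ is a set $X$ with a map $\xi\colon X\to FX$ and an initial state $x_0\in X$ (equivalently a map $1\to X$). Maps $X\to FY$ are ordered pointwise: $f\sqsubseteq g$ iff $f(x)(a,y)\le g(x)(a,y)$ for all $x,a,y$. A lax homomorphism $(X,\xi,x_0)\to(Y,\zeta,y_0)$ is a map $f\colon X\to Y$ with $f(x_0)=y_0$ and $Ff\circ\xi\sqsubseteq\zeta\circ f$; it is a proper homomorphism if moreover $Ff\circ\xi=\zeta\circ f$.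 Pointed coalgebras and lax homomorphisms form the category $\mathsf{LCoalg}(1,F)$. A pointed coalgebra is reachable if every state can be reached from the initial state by a finite sequence of transitions of positive weight (there is such a transition from $x$ to $x'$ if $\xi(x)(a,x')>0$ for some $a\in A$). Two pointed coalgebras $X,Y$ are coalgebraically bisimilar if there are a pointed coalgebra $Z$ and proper homomorphisms $Z\to X$, $Z\to Y$. For a functor $J\colon\mathbb{P}\to\mathbb{M}$, a morphism $f\colon X\to Y$ of $\mathbb{M}$ is $J$-open if for every $e\colon v\to w$ in $\mathbb{P}$ and all $r\colon Jv\to X$, $s\colon Jw\to Y$ in $\mathbb{M}$ with $s\circ Je=f\circ r$ there is $d\colon Jw\to X$ in $\mathbb{M}$ with $f\circ d=s$ and $d\circ Je=r$. Objects $X,Y$ are $J$-bisimilar if there are an object $Z$ and $J$-open morphisms $Z\to X$, $Z\to Y$.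
   Formalization: The set A of labels is assumed non-empty; for empty A both claims are false, since every lax homomorphism is proper, all objects are coalgebraically bisimilar, and the empty category P makes every morphism J-open. -}

module Defs where

open import Level using (Level; _⊔_; suc)
open import Axiom.ExcludedMiddle using (ExcludedMiddle)
open import Data.Bool.Base using (if_then_else_)
open import Data.List.Base using (List; []; _∷_; map; filter; foldr; deduplicate)
open import Data.List.Membership.Propositional using (_∈_; _∉_)
open import Data.List.Membership.Propositional.Properties using (∈-map⁺; ∈-deduplicate⁺)
open import Data.List.Relation.Unary.All using ([]; _∷_)
open import Data.List.Relation.Unary.All.Properties using (All¬⇒¬Any)
open import Data.List.Relation.Unary.Any using (here; there)
open import Data.List.Relation.Unary.Unique.Propositional using (Unique)
open import Data.List.Relation.Unary.AllPairs using ([]; _∷_)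
import Data.List.Relation.Unary.Unique.DecPropositional.Properties as DecUnique
open import Data.Nat.Base as ℕ using (ℕ)
import Data.Nat.Properties as ℕ
open import Data.Product.Base using (Σ-syntax; _×_; _,_; proj₁; proj₂; map₂)
open import Data.Rational.Base as ℚ using (ℚ; 0ℚ; 1ℚ; ½; ∣_∣)
import Data.Rational.Properties as ℚ
open import Data.Rational.Solver using (module +-*-Solver)
open import Function.Base using (_∘_; id)
open import Relation.Binary.Core using (Rel)
open import Relation.Binary.Structures using (IsEquivalence)
open import Relation.Binary.Construct.Closure.ReflexiveTransitive using (Star)
open import Relation.Binary.PropositionalEquality
  using (_≡_; _≗_; refl; sym; trans; cong; subst)
open import Relation.Nullary using (Dec; yes; no; does; contradiction)
open import Relation.Unary using (Pred; Decidable)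

infix  4 _≤_ _<_ _≈_
infixl 6 _+_

-- Cauchy sequences of rationals; equality of reals is _≈_, not _≡_.
record ℝ : Set where
  no-eta-equality
  field
    seq    : ℕ → ℚ
    cauchy : ∀ ε → 0ℚ ℚ.< ε →
             Σ[ N ∈ ℕ ] (∀ m n → N ℕ.≤ m → N ℕ.≤ n → ∣ seq m ℚ.- seq n ∣ ℚ.≤ ε)

open ℝ public

record _≤_ (x y : ℝ) : Set where
  field
    eventually-≤ : ∀ ε → 0ℚ ℚ.< ε →
                   Σ[ N ∈ ℕ ] (∀ n → N ℕ.≤ n → seq x n ℚ.≤ seq y n ℚ.+ ε)

open _≤_ public

_<_ : Rel ℝ _
x < y = Σ[ ε ∈ ℚ ] (0ℚ ℚ.< ε × Σ[ N ∈ ℕ ] (∀ n → N ℕ.≤ n → seq x n ℚ.+ ε ℚ.≤ seq y n))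

-- Equivalently, the difference of the two sequences tends to 0.
_≈_ : Rel ℝ _
x ≈ y = x ≤ y × y ≤ x

private
  half : ∀ ε → 0ℚ ℚ.< ε → 0ℚ ℚ.< ½ ℚ.* ε
  half ε 0<ε = subst (ℚ._< ½ ℚ.* ε) (ℚ.*-zeroʳ ½) (ℚ.*-monoʳ-<-pos ½ 0<ε)

  half+half : ∀ ε → ½ ℚ.* ε ℚ.+ ½ ℚ.* ε ≡ ε
  half+half ε = trans (sym (ℚ.*-distribʳ-+ ε ½ ½)) (ℚ.*-identityˡ ε)

  weaken : ∀ {p ε} → 0ℚ ℚ.< ε → p ℚ.≤ p ℚ.+ ε
  weaken {p} {ε} 0<ε =
    subst (ℚ._≤ p ℚ.+ ε) (ℚ.+-identityʳ p) (ℚ.+-monoʳ-≤ p (ℚ.<⇒≤ 0<ε))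

  diff-+ : ∀ p q r s → (p ℚ.+ q) ℚ.- (r ℚ.+ s) ≡ (p ℚ.- r) ℚ.+ (q ℚ.- s)
  diff-+ = solve 4 (λ p q r s → (p :+ q) :- (r :+ s) := (p :- r) :+ (q :- s)) refl
    where open +-*-Solver

  interchange : ∀ p q r s → (p ℚ.+ q) ℚ.+ (r ℚ.+ s) ≡ (p ℚ.+ r) ℚ.+ (q ℚ.+ s)
  interchange = solve 4 (λ p q r s → (p :+ q) :+ (r :+ s) := (p :+ r) :+ (q :+ s)) refl
    where open +-*-Solver

_+_ : ℝ → ℝ → ℝ
seq (x + y) n = seq x n ℚ.+ seq y n
cauchy (x + y) ε 0<ε =
  let ε/2 = ½ ℚ.* ε
      (M , hx) = cauchy x ε/2 (half ε 0<ε)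
      (N , hy) = cauchy y ε/2 (half ε 0<ε)
  in M ℕ.⊔ N , λ m n m≥ n≥ → begin
    ∣ (seq x m ℚ.+ seq y m) ℚ.- (seq x n ℚ.+ seq y n) ∣
      ≡⟨ cong ∣_∣ (diff-+ (seq x m) (seq y m) (seq x n) (seq y n)) ⟩
    ∣ (seq x m ℚ.- seq x n) ℚ.+ (seq y m ℚ.- seq y n) ∣
      ≤⟨ ℚ.∣p+q∣≤∣p∣+∣q∣ (seq x m ℚ.- seq x n) (seq y m ℚ.- seq y n) ⟩
    ∣ seq x m ℚ.- seq x n ∣ ℚ.+ ∣ seq y m ℚ.- seq y n ∣
      ≤⟨ ℚ.+-mono-≤
           (hx m n (ℕ.≤-trans (ℕ.m≤m⊔n M N) m≥) (ℕ.≤-trans (ℕ.m≤m⊔n M N) n≥))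
           (hy m n (ℕ.≤-trans (ℕ.m≤n⊔m M N) m≥) (ℕ.≤-trans (ℕ.m≤n⊔m M N) n≥)) ⟩
    ε/2 ℚ.+ ε/2
      ≡⟨ half+half ε ⟩
    ε ∎
  where open ℚ.≤-Reasoning

fromℚ : ℚ → ℝ
seq (fromℚ q) _ = q
cauchy (fromℚ q) ε 0<ε =
  0 , λ _ _ _ _ → subst (ℚ._≤ ε) (sym (cong ∣_∣ (ℚ.+-inverseʳ q))) (ℚ.<⇒≤ 0<ε)

0ℝ 1ℝ : ℝ
0ℝ = fromℚ 0ℚ
1ℝ = fromℚ 1ℚ

≤-pointwise : ∀ {x y} → (∀ n → seq x n ℚ.≤ seq y n) → x ≤ y
eventually-≤ (≤-pointwise h) ε 0<ε = 0 , λ n _ → ℚ.≤-trans (h n) (weaken 0<ε)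

≤-refl : ∀ {x} → x ≤ x
≤-refl {x} = ≤-pointwise (λ _ → ℚ.≤-refl)

≤-trans : ∀ {x y z} → x ≤ y → y ≤ z → x ≤ z
eventually-≤ (≤-trans {x} {y} {z} x≤y y≤z) ε 0<ε =
  let ε/2 = ½ ℚ.* ε
      (M , p) = eventually-≤ x≤y ε/2 (half ε 0<ε)
      (N , q) = eventually-≤ y≤z ε/2 (half ε 0<ε)
  in M ℕ.⊔ N , λ n n≥ → begin
    seq x n                       ≤⟨ p n (ℕ.≤-trans (ℕ.m≤m⊔n M N) n≥) ⟩
    seq y n ℚ.+ ε/2               ≤⟨ ℚ.+-monoˡ-≤ ε/2 (q n (ℕ.≤-trans (ℕ.m≤n⊔m M N) n≥)) ⟩
    (seq z n ℚ.+ ε/2) ℚ.+ ε/2     ≡⟨ ℚ.+-assoc (seq z n) ε/2 ε/2 ⟩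
    seq z n ℚ.+ (ε/2 ℚ.+ ε/2)     ≡⟨ cong (seq z n ℚ.+_) (half+half ε) ⟩
    seq z n ℚ.+ ε                 ∎
  where open ℚ.≤-Reasoning

+-mono-≤ : ∀ {x y u v} → x ≤ y → u ≤ v → x + u ≤ y + v
eventually-≤ (+-mono-≤ {x} {y} {u} {v} x≤y u≤v) ε 0<ε =
  let ε/2 = ½ ℚ.* ε
      (M , p) = eventually-≤ x≤y ε/2 (half ε 0<ε)
      (N , q) = eventually-≤ u≤v ε/2 (half ε 0<ε)
  in M ℕ.⊔ N , λ n n≥ → begin
    seq x n ℚ.+ seq u n
      ≤⟨ ℚ.+-mono-≤ (p n (ℕ.≤-trans (ℕ.m≤m⊔n M N) n≥)) (q n (ℕ.≤-trans (ℕ.m≤n⊔m M N) n≥)) ⟩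
    (seq y n ℚ.+ ε/2) ℚ.+ (seq v n ℚ.+ ε/2)
      ≡⟨ interchange (seq y n) ε/2 (seq v n) ε/2 ⟩
    (seq y n ℚ.+ seq v n) ℚ.+ (ε/2 ℚ.+ ε/2)
      ≡⟨ cong ((seq y n ℚ.+ seq v n) ℚ.+_) (half+half ε) ⟩
    (seq y n ℚ.+ seq v n) ℚ.+ ε ∎
  where open ℚ.≤-Reasoning

≈-refl : ∀ {x} → x ≈ x
≈-refl {x} = ≤-refl , ≤-refl

≈-sym : ∀ {x y} → x ≈ y → y ≈ x
≈-sym (p , q) = q , p

≈-trans : ∀ {x y z} → x ≈ y → y ≈ z → x ≈ z
≈-trans {x} {y} {z} (p , p′) (q , q′) = ≤-trans p q , ≤-trans q′ p′

≈-pointwise : ∀ {x y} → (∀ n → seq x n ≡ seq y n) → x ≈ y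
≈-pointwise {x} {y} h =
  ≤-pointwise (λ n → ℚ.≤-reflexive (h n)) ,
  ≤-pointwise (λ n → ℚ.≤-reflexive (sym (h n)))

+-cong : ∀ {x y u v} → x ≈ y → u ≈ v → x + u ≈ y + v
+-cong {x} {y} {u} {v} (p , p′) (q , q′) =
  +-mono-≤ p q , +-mono-≤ p′ q′

+-identityˡ : ∀ x → 0ℝ + x ≈ x
+-identityˡ x = ≈-pointwise (λ n → ℚ.+-identityˡ (seq x n))

+-identityʳ : ∀ x → x + 0ℝ ≈ x
+-identityʳ x = ≈-pointwise (λ n → ℚ.+-identityʳ (seq x n))

+-interchange : ∀ x y u v → (x + y) + (u + v) ≈ (x + u) + (y + v)
+-interchange x y u v = ≈-pointwise
  (λ n → interchange (seq x n) (seq y n) (seq u n) (seq v n))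

∑ : ∀ {a} {X : Set a} → List X → (X → ℝ) → ℝ
∑ xs w = foldr (λ x s → w x + s) 0ℝ xs

when : ∀ {p} {P : Set p} → Dec P → ℝ → ℝ
when d r = if does d then r else 0ℝ

module _ {a} {X : Set a} where

  ∑-mono : ∀ (xs : List X) {v w : X → ℝ} → (∀ x → v x ≤ w x) → ∑ xs v ≤ ∑ xs w
  ∑-mono []               h = ≤-refl
  ∑-mono (x ∷ xs) {v} {w} h = +-mono-≤ (h x) (∑-mono xs h)

  ∑-cong : ∀ (xs : List X) {v w : X → ℝ} → (∀ x → x ∈ xs → v x ≈ w x) → ∑ xs v ≈ ∑ xs w
  ∑-cong []               h = ≈-refl
  ∑-cong (x ∷ xs) {v} {w} h =
    +-cong (h x (here refl)) (∑-cong xs (λ y y∈ → h y (there y∈)))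

  ∑-zero : ∀ (xs : List X) {w : X → ℝ} → (∀ x → x ∈ xs → w x ≈ 0ℝ) → ∑ xs w ≈ 0ℝ
  ∑-zero []           h = ≈-refl
  ∑-zero (x ∷ xs) {w} h = ≈-trans
    (+-cong (h x (here refl)) (∑-zero xs (λ y y∈ → h y (there y∈))))
    (+-identityˡ 0ℝ)

  ∑-+ : ∀ (xs : List X) (v w : X → ℝ) → ∑ xs (λ x → v x + w x) ≈ ∑ xs v + ∑ xs w
  ∑-+ []       v w = ≈-sym (+-identityˡ 0ℝ)
  ∑-+ (x ∷ xs) v w = ≈-trans
    (+-cong ≈-refl (∑-+ xs v w))
    (+-interchange (v x) (w x) (∑ xs v) (∑ xs w))

  ∑-filter : ∀ {p} {P : Pred X p} (P? : Decidable P) xs (w : X → ℝ) →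
             ∑ (filter P? xs) w ≈ ∑ xs (λ x → when (P? x) (w x))
  ∑-filter P? []       w = ≈-refl
  ∑-filter P? (x ∷ xs) w with P? x
  ... | yes _ = +-cong ≈-refl (∑-filter P? xs w)
  ... | no  _ = ≈-trans
                  (∑-filter P? xs w) (≈-sym (+-identityˡ (∑ xs u)))
    where u = λ y → when (P? y) (w y)

∑-swap : ∀ {a b} {X : Set a} {Y : Set b} (xs : List X) (ys : List Y) (w : X → Y → ℝ) →
         ∑ xs (λ x → ∑ ys (w x)) ≈ ∑ ys (λ y → ∑ xs (λ x → w x y))
∑-swap []       ys w =
  ≈-sym (∑-zero ys (λ _ _ → ≈-refl))
∑-swap (x ∷ xs) ys w = ≈-trans
  (+-cong ≈-refl (∑-swap xs ys w))
  (≈-sym (∑-+ ys (w x) v))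
  where v = λ y → ∑ xs (λ x → w x y)

when-yes : ∀ {p} {P : Set p} (d : Dec P) r → P → when d r ≈ r
when-yes (yes _) r p = ≈-refl
when-yes (no ¬p) r p = contradiction p ¬p

when-no : ∀ {p} {P : Set p} (d : Dec P) r → (P → when d r ≈ 0ℝ) → when d r ≈ 0ℝ
when-no (yes p) r h = h p
when-no (no _)  r h = ≈-refl

when-≤ : ∀ {p} {P : Set p} (d : Dec P) {r} → 0ℝ ≤ r → when d r ≤ r
when-≤ (yes _) _ = ≤-refl
when-≤ (no _)  h = h

when-≥0 : ∀ {p} {P : Set p} (d : Dec P) {r} → 0ℝ ≤ r → 0ℝ ≤ when d r
when-≥0 (yes _) h = h
when-≥0 (no _)  _ = ≤-refl

when-mono : ∀ {p} {P : Set p} (d : Dec P) {r s} → r ≤ s → when d r ≤ when d s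
when-mono (yes _) h = h
when-mono (no _)  _ = ≤-refl

when-∑ : ∀ {a p} {X : Set a} {P : Set p} (d : Dec P) (xs : List X) (w : X → ℝ) →
         when d (∑ xs w) ≈ ∑ xs (λ x → when d (w x))
when-∑ (yes _) xs w = ≈-refl
when-∑ (no _)  xs w =
  ≈-sym (∑-zero xs (λ _ _ → ≈-refl))

∑-≥0 : ∀ {a} {X : Set a} (xs : List X) {w : X → ℝ} → (∀ x → 0ℝ ≤ w x) → 0ℝ ≤ ∑ xs w
∑-≥0 []           h = ≤-refl
∑-≥0 (x ∷ xs) {w} h = ≤-trans
  (proj₂ (+-identityˡ 0ℝ)) (+-mono-≤ (h x) (∑-≥0 xs h))

-- P x is x ≡ y with its equation in either orientation.
module _ {a p} {X : Set a} (y : X) {P : Pred X p} (P? : Decidable P) (w : X → ℝ)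
         (P⇒≡ : ∀ x → P x → x ≡ y) where

  ∑-δ-∉ : ∀ xs → y ∉ xs → ∑ xs (λ x → when (P? x) (w x)) ≈ 0ℝ
  ∑-δ-∉ xs y∉ = ∑-zero xs λ x x∈ → when-no (P? x) (w x)
    λ px → contradiction (subst (_∈ xs) (P⇒≡ x px) x∈) y∉

  ∑-δ-∈ : ∀ xs → P y → Unique xs → y ∈ xs → ∑ xs (λ x → when (P? x) (w x)) ≈ w y
  ∑-δ-∈ (_ ∷ xs) py (y∉ ∷ _) (here refl) = ≈-trans
    (+-cong (when-yes (P? y) (w y) py) (∑-δ-∉ xs (All¬⇒¬Any y∉)))
    (+-identityʳ (w y))
  ∑-δ-∈ (x ∷ xs) py (x∉ ∷ u) (there y∈) = ≈-trans
    (+-cong (when-no (P? x) (w x)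
        λ px → contradiction (subst (_∈ xs) (sym (P⇒≡ x px)) y∈) (All¬⇒¬Any x∉))
      (∑-δ-∈ xs py u y∈))
    (+-identityˡ (w y))

-- The support is any repetition-free list off which the weight vanishes; it
-- is not taken into account when subdistributions are compared.
record 𝒟≤1 {ℓ} (X : Set ℓ) : Set ℓ where
  field
    weight   : X → ℝ
    weight≥0 : ∀ x → 0ℝ ≤ weight x
    weight≤1 : ∀ x → weight x ≤ 1ℝ
    support  : List X
    unique   : Unique support
    finite   : ∀ x → x ∉ support → weight x ≈ 0ℝ
    total≤1  : ∑ support weight ≤ 1ℝ

open 𝒟≤1 public

-- Classical logic decides which x satisfy f x ≡ y, so that the sum of the
-- weights over the fibre of y is defined.
module _ {ℓ} (em : ExcludedMiddle ℓ) where

  private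
    _≟_ : ∀ {X : Set ℓ} (x y : X) → Dec (x ≡ y)
    x ≟ y = em

  pushforward : ∀ {X Y : Set ℓ} → (X → Y) → 𝒟≤1 X → Y → ℝ
  pushforward f μ y = ∑ (filter (λ x → em {f x ≡ y}) (support μ)) (weight μ)

  private
    pf : ∀ {X Y : Set ℓ} → (X → Y) → 𝒟≤1 X → Y → ℝ
    pf f μ y = ∑ (support μ) (λ x → when (f x ≟ y) (weight μ x))

    pushforward≈pf : ∀ {X Y : Set ℓ} (f : X → Y) μ y → pushforward f μ y ≈ pf f μ y
    pushforward≈pf f μ y = ∑-filter (λ x → f x ≟ y) (support μ) (weight μ)

    pf≤total : ∀ {X Y : Set ℓ} (f : X → Y) μ y → pf f μ y ≤ ∑ (support μ) (weight μ)
    pf≤total f μ y = ∑-mono (support μ) (λ x → when-≤ (f x ≟ y) (weight≥0 μ x))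

    image : ∀ {X Y : Set ℓ} → (X → Y) → 𝒟≤1 X → List Y
    image f μ = deduplicate _≟_ (map f (support μ))

    image-unique : ∀ {X Y : Set ℓ} (f : X → Y) μ → Unique (image f μ)
    image-unique f μ = DecUnique.deduplicate-! _≟_ (map f (support μ))

    ∈-image : ∀ {X Y : Set ℓ} (f : X → Y) μ {x} → x ∈ support μ → f x ∈ image f μ
    ∈-image f μ x∈ = ∈-deduplicate⁺ _≟_ (∈-map⁺ f x∈)

    ∑-image : ∀ {X Y : Set ℓ} (f : X → Y) μ (h : Y → ℝ → ℝ) →
      (∀ y → h y (pushforward f μ y) ≈
             ∑ (support μ) (λ x → h y (when (f x ≟ y) (weight μ x)))) →
      (∀ x y → h y (when (f x ≟ y) (weight μ x)) ≈ when (f x ≟ y) (h y (weight μ x))) →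
      ∑ (image f μ) (λ y → h y (pushforward f μ y)) ≈
      ∑ (support μ) (λ x → h (f x) (weight μ x))
    ∑-image f μ h lin comm =
      ≈-trans
        (∑-cong ys (λ y _ → lin y))
        (≈-trans
          (∑-swap ys xs t)
          (∑-cong xs λ x x∈ →
            ≈-trans
              (∑-cong ys (λ y _ → comm x y))
              (∑-δ-∈ (f x) (f x ≟_) (λ y → h y (weight μ x)) (λ _ → sym) ys
                refl (image-unique f μ) (∈-image f μ x∈))))
      where
        xs = support μ
        ys = image f μ
        t = λ y x → h y (when (f x ≟ y) (weight μ x))

  𝒟-map : ∀ {X Y : Set ℓ} → (X → Y) → 𝒟≤1 X → 𝒟≤1 Y
  weight   (𝒟-map f μ) = pushforward f μ
  weight≥0 (𝒟-map f μ) y = ∑-≥0 (filter (λ x → f x ≟ y) (support μ)) (weight≥0 μ)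
  weight≤1 (𝒟-map f μ) y = ≤-trans
    (proj₁ (pushforward≈pf f μ y))
    (≤-trans (pf≤total f μ y) (total≤1 μ))
  support  (𝒟-map f μ) = image f μ
  unique   (𝒟-map f μ) = image-unique f μ
  finite   (𝒟-map f μ) y y∉ = ≈-trans
    (pushforward≈pf f μ y)
    (∑-zero (support μ) λ x x∈ → when-no (f x ≟ y) (weight μ x)
      λ fx≡y → contradiction (subst (_∈ image f μ) fx≡y (∈-image f μ x∈)) y∉)
  total≤1  (𝒟-map f μ) =
    ≤-trans
      (proj₁ (∑-image f μ (λ _ r → r) (pushforward≈pf f μ)
                (λ x y → ≈-refl)))
      (total≤1 μ)

  𝒟-map-id : ∀ {X : Set ℓ} (μ : 𝒟≤1 X) y → weight (𝒟-map id μ) y ≈ weight μ y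
  𝒟-map-id μ y = ≈-trans
    (pushforward≈pf id μ y) (lemma em)
    where
    lemma : Dec (y ∈ support μ) → pf id μ y ≈ weight μ y
    lemma (yes y∈) =
      ∑-δ-∈ y (_≟ y) (weight μ) (λ _ → id) (support μ) refl (unique μ) y∈
    lemma (no y∉)  = ≈-trans
      (∑-δ-∉ y (_≟ y) (weight μ) (λ _ → id) (support μ) y∉)
      (≈-sym (finite μ y y∉))

  𝒟-map-∘ : ∀ {X Y Z : Set ℓ} (g : Y → Z) (f : X → Y) (μ : 𝒟≤1 X) z →
            weight (𝒟-map (g ∘ f) μ) z ≈ weight (𝒟-map g (𝒟-map f μ)) z
  𝒟-map-∘ g f μ z = ≈-trans
    (pushforward≈pf (g ∘ f) μ z)
    (≈-sym (≈-trans
        (pushforward≈pf g (𝒟-map f μ) z)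
        (∑-image f μ (λ y → when (g y ≟ z)) lin
          (λ x y → comm (g y ≟ z) (f x ≟ y) (weight μ x)))))
    where
    when-cong : ∀ {P : Set ℓ} (d : Dec P) {r s} → r ≈ s → when d r ≈ when d s
    when-cong d {r} {s} (p , q) = when-mono d p , when-mono d q

    lin : ∀ y → when (g y ≟ z) (pushforward f μ y) ≈
                ∑ (support μ) (λ x → when (g y ≟ z) (when (f x ≟ y) (weight μ x)))
    lin y = ≈-trans
      (when-cong (g y ≟ z) (pushforward≈pf f μ y))
      (when-∑ (g y ≟ z) (support μ) (λ x → when (f x ≟ y) (weight μ x)))

    comm : ∀ {P Q : Set ℓ} (d : Dec P) (e : Dec Q) r → when d (when e r) ≈ when e (when d r)
    comm (yes _) (yes _) r = ≈-refl
    comm (yes _) (no _)  r = ≈-refl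
    comm (no _)  (yes _) r = ≈-refl
    comm (no _)  (no _)  r = ≈-refl

  𝒟-map-mono : ∀ {X Y : Set ℓ} (f : X → Y) (μ ν : 𝒟≤1 X) →
               (∀ x → weight μ x ≤ weight ν x) →
               ∀ y → weight (𝒟-map f μ) y ≤ weight (𝒟-map f ν) y
  𝒟-map-mono {X} f μ ν μ≤ν y = ≤-trans
    (proj₁ (pushforward≈pf f μ y))
    (≤-trans
      (∑-mono xs (λ x → when-mono (f x ≟ y) (μ≤ν x)))
      (≤-trans enlarge
        (proj₂ (pushforward≈pf f ν y))))
    where
    xs = support μ
    ys = support ν
    v : X → ℝ
    v x = when (f x ≟ y) (weight ν x)

    v≥0 : ∀ x → 0ℝ ≤ v x
    v≥0 x = when-≥0 (f x ≟ y) (weight≥0 ν x)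

    split : ∀ x → Dec (x ∈ ys) → v x ≤ ∑ ys (λ x′ → when (x ≟ x′) (v x′))
    split x (yes x∈) = proj₂ (∑-δ-∈ x (x ≟_) v (λ _ → sym) ys refl (unique ν) x∈)
    split x (no x∉)  = ≤-trans
      (when-≤ (f x ≟ y) (weight≥0 ν x))
      (≤-trans (proj₁ (finite ν x x∉))
        (∑-≥0 ys (λ x′ → when-≥0 (x ≟ x′) (v≥0 x′))))

    collect : ∀ x′ → Dec (x′ ∈ xs) → ∑ xs (λ x → when (x ≟ x′) (v x′)) ≤ v x′
    collect x′ (yes x′∈) =
      proj₁ (∑-δ-∈ x′ (_≟ x′) (λ _ → v x′) (λ _ → id) xs refl (unique μ) x′∈)
    collect x′ (no x′∉)  = ≤-trans
      (proj₁ (∑-δ-∉ x′ (_≟ x′) (λ _ → v x′) (λ _ → id) xs x′∉)) (v≥0 x′)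

    w : X → X → ℝ
    w x x′ = when (x ≟ x′) (v x′)

    enlarge : ∑ xs v ≤ ∑ ys v
    enlarge = ≤-trans
      (∑-mono xs (λ x → split x em))
      (≤-trans
        (proj₁ (∑-swap xs ys w))
        (∑-mono ys (λ x′ → collect x′ em)))

-- Morphisms are compared by an equivalence _≋_, so that equality of functions
-- can be pointwise without assuming function extensionality.
record Category (o h e : Level) : Set (suc (o ⊔ h ⊔ e)) where
  infix  4 _≋_ _⇒_
  infixr 9 _⊚_
  field
    Obj       : Set o
    _⇒_       : Obj → Obj → Set h
    _≋_       : ∀ {X Y} → Rel (X ⇒ Y) e
    ι         : ∀ {X} → X ⇒ X
    _⊚_       : ∀ {X Y Z} → Y ⇒ Z → X ⇒ Y → X ⇒ Z
    equiv     : ∀ {X Y} → IsEquivalence (_≋_ {X} {Y})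
    ⊚-cong    : ∀ {X Y Z} {g g′ : Y ⇒ Z} {f f′ : X ⇒ Y} → g ≋ g′ → f ≋ f′ → g ⊚ f ≋ g′ ⊚ f′
    identityˡ : ∀ {X Y} (f : X ⇒ Y) → ι ⊚ f ≋ f
    identityʳ : ∀ {X Y} (f : X ⇒ Y) → f ⊚ ι ≋ f
    assoc     : ∀ {W X Y Z} (h : Y ⇒ Z) (g : X ⇒ Y) (f : W ⇒ X) → (h ⊚ g) ⊚ f ≋ h ⊚ (g ⊚ f)

record Functor {o h e o′ h′ e′} (P : Category o h e) (M : Category o′ h′ e′)
               : Set (o ⊔ h ⊔ e ⊔ o′ ⊔ h′ ⊔ e′) where
  private
    module P = Category P
    module M = Category M
  field
    F₀     : P.Obj → M.Obj
    F₁     : ∀ {v w} → v P.⇒ w → F₀ v M.⇒ F₀ w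
    F-cong : ∀ {v w} {f g : v P.⇒ w} → f P.≋ g → F₁ f M.≋ F₁ g
    F-id   : ∀ {v} → F₁ (P.ι {v}) M.≋ M.ι
    F-∘    : ∀ {u v w} (g : v P.⇒ w) (f : u P.⇒ v) → F₁ (g P.⊚ f) M.≋ F₁ g M.⊚ F₁ f

module _ {o h e o′ h′ e′} {P : Category o h e} {M : Category o′ h′ e′}
         (J : Functor P M) where
  private
    module P = Category P
  open Category M
  open Functor J

  IsOpen : ∀ {X Y} → X ⇒ Y → Set (o ⊔ h ⊔ h′ ⊔ e′)
  IsOpen {X} {Y} f =
    ∀ {v w} (e : v P.⇒ w) (r : F₀ v ⇒ X) (s : F₀ w ⇒ Y) → s ⊚ F₁ e ≋ f ⊚ r →
    Σ[ d ∈ F₀ w ⇒ X ] (f ⊚ d ≋ s × d ⊚ F₁ e ≋ r)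

  OpenBisimilar : Obj → Obj → Set (o ⊔ h ⊔ o′ ⊔ h′ ⊔ e′)
  OpenBisimilar X Y =
    Σ[ Z ∈ Obj ] ((Σ[ f ∈ Z ⇒ X ] IsOpen f) × (Σ[ g ∈ Z ⇒ Y ] IsOpen g))

module _ {ℓ} (em : ExcludedMiddle ℓ) (A : Set ℓ) where

  F : Set ℓ → Set ℓ
  F X = 𝒟≤1 (A × X)

  F-map : ∀ {X Y} → (X → Y) → F X → F Y
  F-map f = 𝒟-map em (map₂ f)

  infix 4 _⊑_ _≐_

  _⊑_ : ∀ {X Y : Set ℓ} → Rel (X → F Y) ℓ
  f ⊑ g = ∀ x a y → weight (f x) (a , y) ≤ weight (g x) (a , y)

  _≐_ : ∀ {X Y : Set ℓ} → Rel (X → F Y) ℓ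
  f ≐ g = ∀ x a y → weight (f x) (a , y) ≈ weight (g x) (a , y)

  record PointedCoalgebra : Set (suc ℓ) where
    field
      State     : Set ℓ
      structure : State → F State
      initial   : State

  open PointedCoalgebra

  record LaxHom (X Y : PointedCoalgebra) : Set ℓ where
    field
      fun     : State X → State Y
      pointed : fun (initial X) ≡ initial Y
      lax     : F-map fun ∘ structure X ⊑ structure Y ∘ fun

  open LaxHom

  IsProper : ∀ {X Y} → LaxHom X Y → Set ℓ
  IsProper {X} {Y} f = F-map (fun f) ∘ structure X ≐ structure Y ∘ fun f

  Reachable : PointedCoalgebra → Set ℓ
  Reachable X = ∀ x → Star _⟶_ (initial X) x
    where
    _⟶_ : Rel (State X) ℓ
    x ⟶ x′ = Σ[ a ∈ A ] 0ℝ < weight (structure X x) (a , x′)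

  Bisimilar : PointedCoalgebra → PointedCoalgebra → Set (suc ℓ)
  Bisimilar X Y =
    Σ[ Z ∈ PointedCoalgebra ]
      ((Σ[ f ∈ LaxHom Z X ] IsProper f) × (Σ[ g ∈ LaxHom Z Y ] IsProper g))

  idHom : ∀ {X} → LaxHom X X
  fun     idHom = id
  pointed idHom = refl
  lax     (idHom {X}) x a y = proj₁ (𝒟-map-id em (structure X x) (a , y))

  compHom : ∀ {X Y Z} → LaxHom Y Z → LaxHom X Y → LaxHom X Z
  fun     (compHom g f) = fun g ∘ fun f
  pointed (compHom g f) = trans (cong (fun g) (pointed f)) (pointed g)
  lax     (compHom {X} {Y} {Z} g f) x a z =
    ≤-trans
      (proj₁ (𝒟-map-∘ em (map₂ (fun g)) (map₂ (fun f)) μ (a , z)))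
      (≤-trans
        (𝒟-map-mono em (map₂ (fun g)) (F-map (fun f) μ) ν (λ (b , y) → lax f x b y) (a , z))
        (lax g (fun f x) a z))
    where
    μ = structure X x
    ν = structure Y (fun f x)

  LCoalg : Category (suc ℓ) ℓ ℓ
  LCoalg = record
    { Obj       = PointedCoalgebra
    ; _⇒_       = LaxHom
    ; _≋_       = λ f g → fun f ≗ fun g
    ; ι         = idHom
    ; _⊚_       = compHom
    ; equiv     = record
      { refl  = λ _ → refl
      ; sym   = λ p x → sym (p x)
      ; trans = λ p q x → trans (p x) (q x)
      }
    ; ⊚-cong    = λ {_} {_} {_} {g} {g′} {f} {f′} p q x →
                    trans (p (fun f x)) (cong (fun g′) (q x))
    ; identityˡ = λ _ _ → refl
    ; identityʳ = λ _ _ → refl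
    ; assoc     = λ _ _ _ _ → refl
    }

{-# OPTIONS --safe #-}

-- Let Y (loop) be a single state with a loop of weight 1, split evenly into the
-- complete graphs X n (uniform n) with n + 1 states and transitions of weight
-- 1/(n + 1), and let D (deadlock) be a single state without transitions.  A square
-- from Je : Jv → Jw to D → Y forces Jv to have no transitions, so Jv maps to the
-- initial state of any coalgebra.  If Z → Y is open and Z maps to X n, the
-- resulting lifting Jw → Z → X n bounds every weight of Jw by 1/(n + 1).  When
-- there is such a Z for every n, Jw has no transitions either, so D → Y is open.
-- But D and Y are not bisimilar, whereas each X n → Y is proper.

module Submission where

import Algebra.Properties.Monoid.Mult as Mult
open import Axiom.ExcludedMiddle using (ExcludedMiddle)
open import Data.Fin.Base using (Fin; zero)
open import Data.Integer.Base as ℤ using (+_; +[1+_])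
import Data.Integer.Properties as ℤ
import Data.Integer.Solver as ℤSolver
open import Data.List.Base using (List; []; _∷_; map; filter; length; allFin)
open import Data.List.Membership.Propositional using (_∈_)
open import Data.List.Membership.Propositional.Properties
  using (∈-map⁺; ∈-map⁻; ∈-allFin; ∈-filter⁺)
open import Data.List.Properties using (filter-all; filter-none; length-map; length-tabulate)
import Data.List.Relation.Unary.All as All
import Data.List.Relation.Unary.AllPairs as AllPairs
open import Data.List.Relation.Unary.Any using (here; there)
import Data.List.Relation.Unary.Unique.Propositional.Properties as Unique
open import Data.Nat.Base as ℕ using (ℕ)
open import Data.Nat.Coprimality using (1-coprimeTo)
import Data.Nat.Properties as ℕ
open import Data.Product.Base using (Σ-syntax; _×_; _,_; proj₁; proj₂; map₂)
open import Data.Rational.Base as ℚ using (ℚ; mkℚ; 0ℚ; 1ℚ; ½; toℚᵘ)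
import Data.Rational.Properties as ℚ
open import Data.Rational.Unnormalised.Base as ℚᵘ using (mkℚᵘ)
import Data.Rational.Unnormalised.Properties as ℚᵘ
open import Data.Unit.Polymorphic.Base using (⊤)
open import Defs
open import Function.Base using (id)
open import Function.Bundles using (_⇔_; module Equivalence)
open import Level using (Lift; lift)
open import Relation.Binary.Construct.Closure.ReflexiveTransitive using (ε; _◅_)
open import Relation.Binary.PropositionalEquality
  using (_≡_; refl; sym; trans; cong; cong₂; subst)
open import Relation.Nullary using (¬_; Dec; yes; no; contradiction)
open import Relation.Nullary.Decidable using (toWitnessFalse)

-- Unit fractions and the Archimedean property

open Mult ℚ.+-0-monoid using () renaming (_×_ to _·_)

1/1+_ : ℕ → ℚ
1/1+ n = mkℚ (+ 1) n (1-coprimeTo (ℕ.suc n))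

-- Unnormalised rationals allow `n + 1` to stay the common denominator, so the induction step
-- reduces to a polynomial identity of integers.
·-1/1+ : ∀ k n → toℚᵘ (k · (1/1+ n)) ℚᵘ.≃ mkℚᵘ (+ k) n
·-1/1+ ℕ.zero    n = ℚᵘ.*≡* refl
·-1/1+ (ℕ.suc k) n = begin
  toℚᵘ (1/1+ n ℚ.+ k · (1/1+ n))          ≈⟨ ℚ.toℚᵘ-homo-+ (1/1+ n) (k · (1/1+ n)) ⟩
  mkℚᵘ (+ 1) n ℚᵘ.+ toℚᵘ (k · (1/1+ n))   ≈⟨ ℚᵘ.+-congʳ (mkℚᵘ (+ 1) n) (·-1/1+ k n) ⟩
  mkℚᵘ (+ 1) n ℚᵘ.+ mkℚᵘ (+ k) n          ≈⟨ ℚᵘ.*≡* (numerators (+ k) (+[1+ n ])) ⟩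
  mkℚᵘ (+[1+ k ]) n                       ∎
  where
  open ℚᵘ.≃-Reasoning
  open ℤSolver.+-*-Solver
  numerators : ∀ k d → (+ 1 ℤ.* d ℤ.+ k ℤ.* d) ℤ.* d ≡ (+ 1 ℤ.+ k) ℤ.* (d ℤ.* d)
  numerators = solve 2
    (λ k d → (con (+ 1) :* d :+ k :* d) :* d := (con (+ 1) :+ k) :* (d :* d)) refl

suc-·-1/1+ : ∀ n → ℕ.suc n · (1/1+ n) ≡ 1ℚ
suc-·-1/1+ n = ℚ.toℚᵘ-injective
  (ℚᵘ.≃-trans (·-1/1+ (ℕ.suc n) n) (ℚᵘ.*≡* (ℤ.*-comm (+[1+ n ]) (+ 1))))

0<1/1+ : ∀ n → 0ℚ ℚ.< 1/1+ n
0<1/1+ n = ℚ.positive⁻¹ (1/1+ n)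

1/1+≤1 : ∀ n → 1/1+ n ℚ.≤ 1ℚ
1/1+≤1 n = ℚ.*≤* (ℤ.*-monoˡ-≤-nonNeg (+ 1) {+ 1} {+[1+ n ]} (ℤ.+≤+ (ℕ.s≤s ℕ.z≤n)))

archimedean : ∀ δ → 0ℚ ℚ.< δ → Σ[ n ∈ ℕ ] 1/1+ n ℚ.≤ δ
archimedean δ 0<δ with ℚ.positive 0<δ
archimedean (mkℚ +[1+ p ] d _) _ | _ =
  -- `mkℚ` stores the denominator minus one, so `1/1+ d` is the given rational with its positive
  -- numerator lowered to 1.
  d , ℚ.*≤* (ℤ.*-monoʳ-≤-nonNeg (+[1+ d ]) {+ 1} {+[1+ p ]} (ℤ.+≤+ (ℕ.s≤s ℕ.z≤n)))

-- Half of the tolerance pays for `1/1+ n`, the other half for the error that `≤` allows.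
≤1/1+⇒≤0 : ∀ {x} → (∀ n → x ≤ fromℚ (1/1+ n)) → x ≤ 0ℝ
eventually-≤ (≤1/1+⇒≤0 {x} h) δ 0<δ =
  let (n , 1/n≤δ/2) = archimedean (½ ℚ.* δ) 0<δ/2
      (N , p)       = eventually-≤ (h n) (½ ℚ.* δ) 0<δ/2
  in N , λ k N≤k → begin
    seq x k                     ≤⟨ p k N≤k ⟩
    (1/1+ n) ℚ.+ ½ ℚ.* δ        ≤⟨ ℚ.+-monoˡ-≤ (½ ℚ.* δ) 1/n≤δ/2 ⟩
    ½ ℚ.* δ ℚ.+ ½ ℚ.* δ         ≡⟨ ℚ.*-distribʳ-+ δ ½ ½ ⟨
    1ℚ ℚ.* δ                    ≡⟨ ℚ.*-identityˡ δ ⟩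
    δ                           ≡⟨ ℚ.+-identityˡ δ ⟨
    0ℚ ℚ.+ δ                    ∎
  where
  open ℚ.≤-Reasoning
  0<δ/2 : 0ℚ ℚ.< ½ ℚ.* δ
  0<δ/2 = subst (ℚ._< ½ ℚ.* δ) (ℚ.*-zeroʳ ½) (ℚ.*-monoʳ-<-pos ½ 0<δ)

fromℚ-mono-≤ : ∀ {p q} → p ℚ.≤ q → fromℚ p ≤ fromℚ q
fromℚ-mono-≤ p≤q = ≤-pointwise (λ _ → p≤q)

1≰0 : ¬ (1ℝ ≤ 0ℝ)
1≰0 1≤0 =
  let (N , p) = eventually-≤ 1≤0 ½ (ℚ.positive⁻¹ ½)
  in toWitnessFalse {a? = 1ℚ ℚ.≤? 0ℚ ℚ.+ ½} _ (p N ℕ.≤-refl)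

-- Bounds on sums and on pushforward weights

module _ {a} {X : Set a} where

  ∑-const : ∀ (xs : List X) {w : X → ℝ} q → (∀ x → x ∈ xs → w x ≈ fromℚ q) →
            ∑ xs w ≈ fromℚ (length xs · q)
  ∑-const []           q h = ≈-refl
  ∑-const (x ∷ xs) {w} q h = ≈-trans
    (+-cong (h x (here refl)) (∑-const xs q (λ y y∈ → h y (there y∈))))
    (≈-pointwise (λ _ → refl))

  ∑-≤0 : ∀ (xs : List X) {w : X → ℝ} → (∀ x → w x ≤ 0ℝ) → ∑ xs w ≤ 0ℝ
  ∑-≤0 xs h = ≤-trans (∑-mono xs h) (proj₁ (∑-zero xs (λ _ _ → ≈-refl)))

  ∈⇒≤∑ : ∀ {xs : List X} {w : X → ℝ} → (∀ x → 0ℝ ≤ w x) → ∀ {x} → x ∈ xs → w x ≤ ∑ xs w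
  ∈⇒≤∑ {xs = x ∷ xs} {w} w≥0 (here refl) =
    ≤-trans (proj₂ (+-identityʳ (w x))) (+-mono-≤ ≤-refl (∑-≥0 xs w≥0))
  ∈⇒≤∑ {xs = y ∷ xs} {w} w≥0 {x} (there x∈) =
    ≤-trans (proj₂ (+-identityˡ (w x))) (+-mono-≤ (w≥0 y) (∈⇒≤∑ w≥0 x∈))

module _ {ℓ} (em : ExcludedMiddle ℓ) where

  -- On the support, `x` is one summand of the fibre over `f x` and the other summands are
  -- nonnegative; off the support its weight is 0.
  weight≤pushforward : ∀ {X Y : Set ℓ} (f : X → Y) μ x →
                       weight μ x ≤ pushforward em f μ (f x)
  weight≤pushforward f μ x with em {x ∈ support μ}
  ... | yes x∈ = ∈⇒≤∑ (weight≥0 μ) (∈-filter⁺ (λ x′ → em {f x′ ≡ f x}) x∈ refl)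
  ... | no  x∉ = ≤-trans (proj₁ (finite μ x x∉)) (weight≥0 (𝒟-map em f μ) (f x))

  pushforward≤0 : ∀ {X Y : Set ℓ} (f : X → Y) μ → (∀ x → weight μ x ≤ 0ℝ) →
                  ∀ y → pushforward em f μ y ≤ 0ℝ
  pushforward≤0 f μ μ≤0 y = ∑-≤0 (filter (λ x → em {f x ≡ y}) (support μ)) μ≤0

  pushforward-const : ∀ {X Y : Set ℓ} (f : X → Y) μ y → (∀ {x} → x ∈ support μ → f x ≡ y) →
                      pushforward em f μ y ≡ ∑ (support μ) (weight μ)
  pushforward-const f μ y h = cong (λ xs → ∑ xs (weight μ))
    (filter-all (λ x → em {f x ≡ y}) (All.tabulate h))

  pushforward-∉ : ∀ {X Y : Set ℓ} (f : X → Y) μ y → (∀ {x} → x ∈ support μ → ¬ (f x ≡ y)) →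
                  pushforward em f μ y ≡ 0ℝ
  pushforward-∉ f μ y h = cong (λ xs → ∑ xs (weight μ))
    (filter-none (λ x → em {f x ≡ y}) (All.tabulate h))

-- Coalgebras without transitions

module _ {ℓ} (em : ExcludedMiddle ℓ) {A : Set ℓ} where

  open PointedCoalgebra
  open LaxHom

  -- Pulls upper bounds on weights back along lax homomorphisms: the bound 0 from `deadlock` and the
  -- bound `1/1+ n` from `uniform n`.
  lax⇒weight-≤ : ∀ {X Y} (f : LaxHom em A X Y) x b x′ →
    weight (structure X x) (b , x′) ≤ weight (structure Y (fun f x)) (b , fun f x′)
  lax⇒weight-≤ {X} f x b x′ = ≤-trans
    (weight≤pushforward em (map₂ (fun f)) (structure X x) (b , x′))
    (lax f x b (fun f x′))

  -- As weights are nonnegative, this bound rules out all transitions.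
  Inert : PointedCoalgebra em A → Set ℓ
  Inert X = ∀ x p → weight (structure X x) p ≤ 0ℝ

  lax-reflects-Inert : ∀ {X Y} → LaxHom em A X Y → Inert Y → Inert X
  lax-reflects-Inert f inert x (b , x′) =
    ≤-trans (lax⇒weight-≤ f x b x′) (inert (fun f x) (b , fun f x′))

  -- Nothing is pushed forward from an inert coalgebra, so laxness is free and a constant map
  -- suffices.
  toInitial : ∀ {X} Y → Inert X → LaxHom em A X Y
  fun     (toInitial Y inert) _ = initial Y
  pointed (toInitial Y inert) = refl
  lax     (toInitial {X} Y inert) x b y = ≤-trans
    (pushforward≤0 em (map₂ (λ _ → initial Y)) (structure X x) (inert x) (b , y))
    (weight≥0 (structure Y (initial Y)) (b , y))

  idHom-proper : ∀ X → IsProper em A (idHom em A {X})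
  idHom-proper X x b y = 𝒟-map-id em (structure X x) (b , y)

  deadlock : PointedCoalgebra em A
  State     deadlock = ⊤
  structure deadlock _ = record
    { weight   = λ _ → 0ℝ
    ; weight≥0 = λ _ → ≤-refl
    ; weight≤1 = λ _ → 0≤1
    ; support  = []
    ; unique   = AllPairs.[]
    ; finite   = λ _ _ → ≈-refl
    ; total≤1  = 0≤1
    }
    where
    0≤1 : 0ℝ ≤ 1ℝ
    0≤1 = fromℚ-mono-≤ (ℚ.<⇒≤ (ℚ.positive⁻¹ 1ℚ))
  initial   deadlock = _

  deadlock-inert : Inert deadlock
  deadlock-inert _ _ = ≤-refl

  deadlock-reachable : Reachable em A deadlock
  deadlock-reachable _ = ε

-- The uniform coalgebras and their collapse onto the loop

module Uniform {ℓ} (em : ExcludedMiddle ℓ) {A : Set ℓ} (a : A) where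

  open PointedCoalgebra
  open LaxHom

  module _ (n : ℕ) where

    transitions : List (A × Lift ℓ (Fin (ℕ.suc n)))
    transitions = map (λ i → a , lift i) (allFin (ℕ.suc n))

    ∈-transitions : ∀ i → (a , i) ∈ transitions
    ∈-transitions (lift i) = ∈-map⁺ (λ i → a , lift i) (∈-allFin i)

    transitions⇒label≡ : ∀ {p} → p ∈ transitions → proj₁ p ≡ a
    transitions⇒label≡ p∈ with ∈-map⁻ (λ i → a , lift i) p∈
    ... | _ , _ , refl = refl

    uniformWeight : A × Lift ℓ (Fin (ℕ.suc n)) → ℝ
    uniformWeight (b , _) = when (em {b ≡ a}) (fromℚ (1/1+ n))

    uniformWeight≥0 : ∀ p → 0ℝ ≤ uniformWeight p
    uniformWeight≥0 (b , _) = when-≥0 (em {b ≡ a}) (fromℚ-mono-≤ (ℚ.<⇒≤ (0<1/1+ n)))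

    uniformWeight≤ : ∀ p → uniformWeight p ≤ fromℚ (1/1+ n)
    uniformWeight≤ (b , _) = when-≤ (em {b ≡ a}) (fromℚ-mono-≤ (ℚ.<⇒≤ (0<1/1+ n)))

    uniformWeight-a : ∀ {b} i → b ≡ a → uniformWeight (b , i) ≈ fromℚ (1/1+ n)
    uniformWeight-a {b} _ b≡a = when-yes (em {b ≡ a}) (fromℚ (1/1+ n)) b≡a

    ∑-uniformWeight : ∑ transitions uniformWeight ≈ 1ℝ
    ∑-uniformWeight = subst (λ q → ∑ transitions uniformWeight ≈ fromℚ q) total
      (∑-const transitions (1/1+ n)
        (λ (_ , i) p∈ → uniformWeight-a i (transitions⇒label≡ p∈)))
      where
      total : length transitions · (1/1+ n) ≡ 1ℚ
      total = trans
        (cong (_· (1/1+ n)) (trans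
          (length-map (λ i → a , lift {ℓ = ℓ} i) (allFin (ℕ.suc n)))
          (length-tabulate {n = ℕ.suc n} id)))
        (suc-·-1/1+ n)

    uniform : PointedCoalgebra em A
    State     uniform = Lift ℓ (Fin (ℕ.suc n))
    structure uniform _ = record
      { weight   = uniformWeight
      ; weight≥0 = uniformWeight≥0
      ; weight≤1 = λ p → ≤-trans (uniformWeight≤ p) (fromℚ-mono-≤ (1/1+≤1 n))
      ; support  = transitions
      ; unique   = Unique.map⁺ (λ { refl → refl }) (Unique.allFin⁺ (ℕ.suc n))
      ; finite   = λ (b , i) p∉ → when-no (em {b ≡ a}) (fromℚ (1/1+ n))
          λ { refl → contradiction (∈-transitions i) p∉ }
      ; total≤1  = proj₁ ∑-uniformWeight
      }
    initial   uniform = lift zero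

    -- The graph is complete with loops, so one transition suffices; `1/1+ n` itself is the rational
    -- gap that `<` asks for.
    uniform-reachable : Reachable em A uniform
    uniform-reachable i =
      (a , 1/1+ n , 0<1/1+ n , proj₁ positive , proj₂ positive) ◅ ε
      where
      positive : Σ[ N ∈ ℕ ] (∀ k → N ℕ.≤ k →
                 seq 0ℝ k ℚ.+ 1/1+ n ℚ.≤ seq (uniformWeight (a , i)) k)
      positive with em {a ≡ a}
      ... | yes _  = 0 , λ _ _ → ℚ.≤-reflexive (ℚ.+-identityˡ (1/1+ n))
      ... | no a≢a = contradiction refl a≢a

  loop : PointedCoalgebra em A
  loop = uniform 0

  -- Makes every square over `loop` commute, so that open maps into `loop` lift without further
  -- conditions.
  loop-state-unique : ∀ (x y : State loop) → x ≡ y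
  loop-state-unique (lift zero) (lift zero) = refl

  -- All transitions of `uniform n` carry the label `a` and are sent to the same pair, where their
  -- weights add up to 1.
  pushforward-uniform : ∀ n (f : State (uniform n) → State loop) x p →
    pushforward em (map₂ f) (structure (uniform n) x) p ≈ uniformWeight 0 p
  pushforward-uniform n f x (b , j) = helper em
    where
    μ = structure (uniform n) x
    ν = structure loop (lift zero)
    helper : Dec (b ≡ a) → pushforward em (map₂ f) μ (b , j) ≈ weight ν (b , j)
    helper (yes refl) = subst (_≈ weight ν (a , j))
      (sym (pushforward-const em (map₂ f) μ (a , j) λ {p} p∈ →
        cong₂ _,_ (transitions⇒label≡ n p∈) (loop-state-unique (f (proj₂ p)) j)))
      -- The weight of the loop is 1 because `1/1+ 0` is `1ℚ` by definition.
      (≈-trans {y = 1ℝ} (∑-uniformWeight n) (≈-sym {y = 1ℝ} (uniformWeight-a 0 j refl)))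
    helper (no b≢a) = subst (_≈ weight ν (b , j))
      (sym (pushforward-∉ em (map₂ f) μ (b , j) λ p∈ eq →
        b≢a (trans (sym (cong proj₁ eq)) (transitions⇒label≡ n p∈))))
      (≈-sym (when-no (em {b ≡ a}) 1ℝ (λ b≡a → contradiction b≡a b≢a)))

  uniform→loop : ∀ n → LaxHom em A (uniform n) loop
  fun     (uniform→loop n) _ = lift zero
  pointed (uniform→loop n) = refl
  lax     (uniform→loop n) x b y = proj₁ (pushforward-uniform n (λ _ → lift zero) x (b , y))

  uniform→loop-proper : ∀ n → IsProper em A (uniform→loop n)
  uniform→loop-proper n x b y = pushforward-uniform n (λ _ → lift zero) x (b , y)

  uniform-bisimilar-loop : ∀ n → Bisimilar em A (uniform n) loop
  uniform-bisimilar-loop n =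
    uniform n , (idHom em A , idHom-proper em (uniform n)) , (uniform→loop n , uniform→loop-proper n)

  deadlock→loop : LaxHom em A (deadlock em) loop
  deadlock→loop = toInitial em loop (deadlock-inert em)

  -- The leg to `deadlock` makes `Z` inert, so its pushforward along `g` vanishes, whereas
  -- properness of `g` demands weight 1.
  ¬deadlock-bisimilar-loop : ¬ Bisimilar em A (deadlock em) loop
  ¬deadlock-bisimilar-loop (Z , (f , _) , (g , g-proper)) = 1≰0
    (≤-trans (proj₂ (uniformWeight-a 0 (fun g z) refl))
      (≤-trans (proj₂ (g-proper z a (fun g z)))
        (pushforward≤0 em (map₂ (fun g)) (structure Z z)
          (lax-reflects-Inert em f (deadlock-inert em) z) (a , fun g z))))
    where z = initial Z

  -- V and W stand for Jv and Jw, and the last component of the hypothesis for lifting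
  -- along an open map from Z to loop.
  lax-to-deadlock : ∀ {V W} → LaxHom em A V (deadlock em) →
    (∀ n → Σ[ Z ∈ PointedCoalgebra em A ]
      (LaxHom em A Z (uniform n) × (LaxHom em A V Z → LaxHom em A W Z))) →
    LaxHom em A W (deadlock em)
  lax-to-deadlock {V} {W} r extend = toInitial em (deadlock em) W-inert
    where
    V-inert : Inert em V
    V-inert = lax-reflects-Inert em r (deadlock-inert em)

    W-inert : Inert em W
    W-inert x (b , x′) = ≤1/1+⇒≤0 λ n →
      let (Z , f , ext) = extend n
          -- The map to be extended exists for every `Z` because `V` is inert.
          k = compHom em A f (ext (toInitial em Z V-inert))
      in ≤-trans (lax⇒weight-≤ em k x b x′) (uniformWeight≤ n (b , fun k x′))

-- The two impossibility results

theorem3p1 : ∀ {ℓ o h e} (em : ExcludedMiddle ℓ) (A : Set ℓ) → A →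
    ¬ (Σ[ P ∈ Category o h e ] Σ[ J ∈ Functor P (LCoalg em A) ]
    (∀ X Y (f : LaxHom em A X Y) → Reachable em A X →
    IsOpen J f ⇔ IsProper em A f))
    ×
    ¬ (Σ[ P ∈ Category o h e ] Σ[ J ∈ Functor P (LCoalg em A) ]
    (∀ X Y → OpenBisimilar J X Y ⇔ Bisimilar em A X Y))
theorem3p1 em A a =
    (λ (_ , _ , open⇔proper) → ¬deadlock-bisimilar-loop
      -- Were `deadlock→loop` open, it would be proper and form with the identity a span of proper
      -- homomorphisms.
      (deadlock em , (idHom em A , idHom-proper em (deadlock em)) ,
        (deadlock→loop , to (open⇔proper _ _ deadlock→loop (deadlock-reachable em))
          λ e r s _ →
            -- Here `uniform n` is its own `Z`: its map to `loop` is proper, hence open.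
            lax-to-deadlock r (λ n → uniform n , idHom em A , λ r′ →
              proj₁ (from (open⇔proper _ _ (uniform→loop n) (uniform-reachable n))
                (uniform→loop-proper n) e r′ s (λ _ → loop-state-unique _ _))) ,
            (λ _ → loop-state-unique _ _) , (λ _ → refl)))) ,
    (λ (_ , _ , open⇔bisimilar) → ¬deadlock-bisimilar-loop (to (open⇔bisimilar _ _)
      -- The identity is open with `s` itself as the lifting.
      (deadlock em , (idHom em A , λ e r s eq → s , (λ _ → refl) , eq) ,
        (deadlock→loop , λ e r s _ →
          lax-to-deadlock r (λ n →
            -- Now openness of `uniform→loop n` is not given; the apex of an open span between
            -- `uniform n` and `loop` takes its place.
            let (Z , (f , _) , (g , g-open)) =
                  from (open⇔bisimilar (uniform n) loop) (uniform-bisimilar-loop n)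
            in Z , f , λ r′ → proj₁ (g-open e r′ s (λ _ → loop-state-unique _ _))) ,
          (λ _ → loop-state-unique _ _) , (λ _ → refl)))))
  where
  open Uniform em a
  open Equivalence using (to; from)
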